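{- Let $k,s$ be integers with $k\geq 3$ and $s\geq 3$. Then: (1) If $3\leq k\leq \binom{s-1}{\lceil (s-1)/2\rceil}+1$, then $\mathrm{GR}_{k}(\mathcal{C}_3:\mathcal{C}_s)=s$. (2) If $k>\binom{s-1}{\lceil (s-1)/2\rceil}+1$, then the pair $(\mathcal{C}_3,\mathcal{C}_s)$ is $(\mathcal{C}_3:\mathcal{C}_s)_k$-good.
   Context: $\mathcal{B}_N$ denotes the Boolean lattice of all subsets of $[N]=\{1,\dots,N\}$ ordered by inclusion. For posets $\mathcal{P},\mathcal{Q}$, an induced copy of $\mathcal{P}$ in $\mathcal{Q}$ is the image of an injection $f:\mathcal{P}\to\mathcal{Q}$ with $f(X)\le f(Y)$ iff $X\le Y$. $\mathcal{C}_t$ is the $t$-element chain. A coloring of $\mathcal{B}_N$ is an assignment of colors to its sets; a $k$-coloring is exact if it uses colors from $[k]$ and every color in $[k]$ is used at least once. A colored subfamily is monochromatic if all its sets have the same color and rainbow if all its sets have pairwise distinct colors. The pair $(\mathcal{Q},\mathcal{P})$ is $(\mathcal{Q}:\mathcal{P})_k$-good if for every positive integer $N$, every exact $k$-coloring of $\mathcal{B}_N$ contains a rainbow induced copy of $\mathcal{Q}$ or a monochromatic induced copy of $\mathcal{P}$. For a pair that is not $(\mathcal{Q}:\mathcal{P})_k$-good, the Boolean Gallai–Ramsey number $\mathrm{GR}_k(\mathcal{Q}:\mathcal{P})$ is the smallest integer $n$ such that for every $N\ge n$, every exact $k$-coloring of $\mathcal{B}_N$ contains a rainbow induced copy of $\mathcal{Q}$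 or a monochromatic induced copy of $\mathcal{P}$. -}

module Defs where

open import Data.Fin using (Fin)
open import Data.Fin.Properties using (≤-poset)
open import Data.Fin.Subset using (Subset)
open import Data.Fin.Subset.Properties using (⊆-poset)
open import Data.Nat using (ℕ; _≤_)
open import Data.Product using (∃; Σ-syntax; _×_)
open import Data.Sum using (_⊎_)
open import Function.Definitions using (StrictlySurjective)
open import Level using (0ℓ)
open import Relation.Binary.Bundles using (Poset)
open import Relation.Binary.Morphism.Structures using (IsOrderMonomorphism)
open import Relation.Binary.PropositionalEquality using (_≡_; _≢_)
open import Relation.Nullary using (¬_)
open import Relation.Unary using (Pred; _∈_)

Pos : Set₁
Pos = Poset 0ℓ 0ℓ 0ℓ

Boolean : ℕ → Pos
Boolean N = ⊆-poset N

Chain : ℕ → Pos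
Chain t = ≤-poset t

-- An order monomorphism is injective and both preserves and reflects the order.
-- The copy itself is the image of the embedding.
record InducedCopy (P Q : Pos) : Set where
  private
    module P = Poset P
    module Q = Poset Q
  field
    embed               : P.Carrier → Q.Carrier
    isOrderMonomorphism : IsOrderMonomorphism P._≈_ Q._≈_ P._≤_ Q._≤_ embed

  image : Pred Q.Carrier 0ℓ
  image y = ∃ λ x → embed x Q.≈ y

open InducedCopy public using (image)

Coloring : ℕ → ℕ → Set
Coloring N k = Subset N → Fin k

Exact : ∀ {N k} → Coloring N k → Set
Exact c = StrictlySurjective _≡_ c

Monochromatic : ∀ {N k} → Coloring N k → Pred (Subset N) 0ℓ → Set
Monochromatic c F = ∀ {X Y} → X ∈ F → Y ∈ F → c X ≡ c Y

Rainbow : ∀ {N k} → Coloring N k → Pred (Subset N) 0ℓ → Set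
Rainbow c F = ∀ {X Y} → X ∈ F → Y ∈ F → X ≢ Y → c X ≢ c Y

Forced : (Q P : Pos) (k N : ℕ) → Set
Forced Q P k N = (c : Coloring N k) → Exact c →
    (Σ[ A ∈ InducedCopy Q (Boolean N) ] Rainbow c (image A))
  ⊎ (Σ[ A ∈ InducedCopy P (Boolean N) ] Monochromatic c (image A))

Good : (Q P : Pos) (k : ℕ) → Set
Good Q P k = ∀ N → 1 ≤ N → Forced Q P k N

ForcedFrom : (Q P : Pos) (k n : ℕ) → Set
ForcedFrom Q P k n = ∀ N → n ≤ N → Forced Q P k N

-- GR_k(Q : P) = n, as a relation: the number is only defined for pairs that
-- are not good, so asserting a value includes asserting non-goodness.
GR[_,_∶_]≡_ : (k : ℕ) (Q P : Pos) (n : ℕ) → Set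
GR[ k , Q ∶ P ]≡ n =
    ¬ Good Q P k
  × ForcedFrom Q P k n
  × (∀ m → ForcedFrom Q P k m → n ≤ m)

{-# OPTIONS --safe #-}
-- Suppose no chain of three sets is rainbow and let z be the color of ∅. Two
-- comparable sets with colors other than z then share their color. Hence sets
-- representing the other k − 1 colors form an antichain, and Sperner's theorem
-- bounds k. If moreover k ≥ 3, fix a set B of color b ≠ z and let A be, among
-- the sets with a color other than z and b, one at least Hamming distance from
-- B. A set with a color other than z that is comparable to both A and B cannot
-- exist, so a full chain through A ∩ B, A and A ∪ B can only leave color z
-- inside [A ∩ B , A ∪ B], and there, by the choice of A, only at A. Its other N
-- sets form a monochromatic chain.
-- Conversely, in the Boolean lattice of dimension s − 1 color the middle level
-- with k − 1 colors and everything else with the remaining one.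
module Submission where

open import Defs
open import Data.Bool.Base using (_xor_)
open import Data.Fin.Base as Fin using (Fin; zero; suc; toℕ; fromℕ<; inject≤; punchIn; punchOut)
import Data.Fin.Properties as Fin
open import Data.Fin.Subset
  using (Side; Subset; inside; outside; ⊥; ⊤; ∣_∣; _∩_; _∪_; _⊆_; _⊂_)
open import Data.Fin.Subset.Properties
open import Data.Nat
  using (ℕ; zero; suc; z≤n; s≤s; s≤s⁻¹; _≤_; _<_; _≤′_; ≤′-refl; ≤′-step;
         _+_; _∸_; _*_; ⌈_/2⌉; ⌊_/2⌋)
open import Data.Nat.Combinatorics using (_C_; nCk+nC[k+1]≡[n+1]C[k+1])
open import Data.Nat.Induction using (<-wellFounded)
open import Data.Nat.Properties as ℕ using (≤-trans; ≤-reflexive)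
open import Data.Product using (Σ-syntax; ∃; ∃-syntax; _×_; _,_; proj₁; proj₂)
open import Data.Sum using (_⊎_; inj₁; inj₂; [_,_])
open import Data.Sum.Function.Propositional using (_⊎-↔_)
open import Data.Vec.Base using ([]; _∷_; zipWith; here)
open import Function.Base using (_∘_)
open import Function.Bundles using (_↔_; mk↔ₛ′; module Inverse; module Injection)
open import Function.Construct.Composition using (_↔-∘_)
open import Function.Construct.Symmetry using (↔-sym)
open import Function.Properties.Inverse using (↔⇒↣)
open import Induction.WellFounded using (Acc; acc)
open import Relation.Binary.Morphism.Structures using (IsOrderMonomorphism)
open import Relation.Binary.PropositionalEquality hiding ([_])
open import Relation.Nullary using (¬_; Dec; yes; no; contradiction; ¬?; _×-dec_; decidable-stable)
open import Relation.Unary using (Decidable)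

private
  variable
    n m k t N : ℕ
    X Y Z : Subset n

-- Subsets

-- `Y` adds to `X` the first coordinate in which `X` and `Z` differ, so that one can ascend towards
-- `Z` rank by rank.
cover : X ⊆ Z → X ≡ Z ⊎ (∃[ Y ] X ⊂ Y × Y ⊆ Z × ∣ Y ∣ ≡ suc ∣ X ∣)
cover {X = []} {[]} _ = inj₁ refl
cover {X = inside ∷ _} {outside ∷ _} X⊆Z with () ← X⊆Z here
cover {X = outside ∷ X} {inside ∷ Z} X⊆Z =
  inj₂ (inside ∷ X , out⊂in ⊆-refl , s⊆s (drop-∷-⊆ X⊆Z) , refl)
cover {X = outside ∷ _} {outside ∷ _} X⊆Z with cover (drop-∷-⊆ X⊆Z)
... | inj₁ X≡Z = inj₁ (cong (outside ∷_) X≡Z)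
... | inj₂ (Y , X⊂Y , Y⊆Z , eq) = inj₂ (outside ∷ Y , s⊂s X⊂Y , s⊆s Y⊆Z , eq)
cover {X = inside ∷ _} {inside ∷ _} X⊆Z with cover (drop-∷-⊆ X⊆Z)
... | inj₁ X≡Z = inj₁ (cong (inside ∷_) X≡Z)
... | inj₂ (Y , X⊂Y , Y⊆Z , eq) = inj₂ (inside ∷ Y , s⊂s X⊂Y , s⊆s Y⊆Z , cong suc eq)

⊆∧≢⇒⊂ : X ⊆ Y → X ≢ Y → X ⊂ Y
⊆∧≢⇒⊂ X⊆Y X≢Y with cover X⊆Y
... | inj₁ X≡Y = contradiction X≡Y X≢Y
... | inj₂ (_ , X⊂X′ , X′⊆Y , _) = ⊂-⊆-trans X⊂X′ X′⊆Y

hamming : Subset n → Subset n → ℕ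
hamming X Y = ∣ zipWith _xor_ X Y ∣

-- Where `A` and `B` agree, `X` is squeezed to the same value; elsewhere `A` already pays for a
-- difference.
hamming-between : (A B X : Subset n) → A ∩ B ⊆ X → X ⊆ A ∪ B → hamming X B ≤ hamming A B
hamming-between [] [] [] _ _ = z≤n
hamming-between (a ∷ A) (b ∷ B) (x ∷ X) l u
  with hamming-between A B X (drop-∷-⊆ l) (drop-∷-⊆ u)
hamming-between (inside ∷ _) (inside ∷ _) (inside ∷ _) l u | ih = ih
hamming-between (inside ∷ _) (inside ∷ _) (outside ∷ _) l u | ih with () ← l here
hamming-between (outside ∷ _) (outside ∷ _) (inside ∷ _) l u | ih with () ← u here
hamming-between (outside ∷ _) (outside ∷ _) (outside ∷ _) l u | ih = ih
hamming-between (inside ∷ _) (outside ∷ _) (inside ∷ _) l u | ih = s≤s ih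
hamming-between (inside ∷ _) (outside ∷ _) (outside ∷ _) l u | ih = ℕ.m≤n⇒m≤1+n ih
hamming-between (outside ∷ _) (inside ∷ _) (inside ∷ _) l u | ih = ℕ.m≤n⇒m≤1+n ih
hamming-between (outside ∷ _) (inside ∷ _) (outside ∷ _) l u | ih = s≤s ih

hamming-between-≡ : (A B X : Subset n) → A ∩ B ⊆ X → X ⊆ A ∪ B →
                    hamming A B ≤ hamming X B → X ≡ A
hamming-between-≡ [] [] [] _ _ _ = refl
hamming-between-≡ (a ∷ A) (b ∷ B) (x ∷ X) l u h
  with hamming-between A B X (drop-∷-⊆ l) (drop-∷-⊆ u)
     | hamming-between-≡ A B X (drop-∷-⊆ l) (drop-∷-⊆ u)
hamming-between-≡ (inside ∷ _) (inside ∷ _) (inside ∷ _) l u h | _ | ih = cong (inside ∷_) (ih h)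
hamming-between-≡ (inside ∷ _) (inside ∷ _) (outside ∷ _) l u h | _ | _ with () ← l here
hamming-between-≡ (outside ∷ _) (outside ∷ _) (inside ∷ _) l u h | _ | _ with () ← u here
hamming-between-≡ (outside ∷ _) (outside ∷ _) (outside ∷ _) l u h | _ | ih = cong (outside ∷_) (ih h)
hamming-between-≡ (inside ∷ _) (outside ∷ _) (inside ∷ _) l u h | _ | ih =
  cong (inside ∷_) (ih (s≤s⁻¹ h))
-- Here `X` agrees with `B` where `A` does not, and the other coordinates cannot make up for it.
hamming-between-≡ (inside ∷ _) (outside ∷ _) (outside ∷ _) l u h | le | _ =
  contradiction (≤-trans h le) ℕ.1+n≰n
hamming-between-≡ (outside ∷ _) (inside ∷ _) (inside ∷ _) l u h | le | _ =
  contradiction (≤-trans h le) ℕ.1+n≰n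
hamming-between-≡ (outside ∷ _) (inside ∷ _) (outside ∷ _) l u h | _ | ih =
  cong (outside ∷_) (ih (s≤s⁻¹ h))

minimiser : (μ : Subset n → ℕ) {P : Subset n → Set} → Decidable P → ∃ P →
            ∃[ X ] P X × (∀ Y → P Y → μ X ≤ μ Y)
minimiser μ {P} P? (X , pX) = go X pX (<-wellFounded (μ X))
  where
  go : ∀ X → P X → Acc _<_ (μ X) → ∃[ X ] P X × (∀ Y → P Y → μ X ≤ μ Y)
  go X pX (acc rec) with anySubset? (λ Y → P? Y ×-dec (μ Y ℕ.<? μ X))
  ... | yes (Y , pY , Y<X) = go Y pY (rec Y<X)
  ... | no none = X , pX , λ Y pY → ℕ.≮⇒≥ λ Y<X → none (Y , pY , Y<X)

-- Chains of subsets

-- The bottom set is exempt from `P`, so segments can be glued at their ends. The index counts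
-- steps, one fewer than the sets.
data Tower {N : ℕ} (P : Subset N → Set) : Subset N → ℕ → Set where
  []   : Tower P X 0
  step : X ⊂ Y → P Y → Tower P Y t → Tower P X (suc t)

module _ {P : Subset N → Set} where

  lookup : Tower P X t → Fin (suc t) → Subset N
  lookup {X = X} _     zero    = X
  lookup (step _ _ T) (suc i) = lookup T i

  lookup-first : (T : Tower P X t) → ∀ i → X ⊆ lookup T i
  lookup-first T              zero    = ⊆-refl
  lookup-first (step X⊂Y _ T) (suc i) = ⊆-trans (proj₁ X⊂Y) (lookup-first T i)

  lookup-mono : (T : Tower P X t) → ∀ i j → i Fin.< j → lookup T i ⊂ lookup T j
  lookup-mono (step X⊂Y _ T) zero    (suc j) _   = ⊂-⊆-trans X⊂Y (lookup-first T j)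
  lookup-mono (step _ _ T)   (suc i) (suc j) i<j = lookup-mono T i j (s≤s⁻¹ i<j)

  lookup-∈ : P X → (T : Tower P X t) → ∀ i → P (lookup T i)
  lookup-∈ pX T             zero    = pX
  lookup-∈ _  (step _ pY T) (suc i) = lookup-∈ pY T i

  take : m ≤ t → Tower P X t → Tower P X m
  take z≤n       _              = []
  take (s≤s m≤t) (step X⊂Y p T) = step X⊂Y p (take m≤t T)

  -- So many steps that each adds exactly one element; the equation avoids truncated subtraction.
  FullTower : Subset N → Set
  FullTower X = ∀ d → d + ∣ X ∣ ≡ N → Tower P X d

  -- Puts unit steps from `X` to `Z` below a full tower from `Z`; the recursion is on the number of
  -- steps left.
  climb : X ⊆ Z → (∀ Y → X ⊆ Y → Y ⊆ Z → P Y) → FullTower Z → FullTower X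
  climb X⊆Z all T d eq with cover X⊆Z
  ... | inj₁ refl = T d eq
  climb X⊆Z all T zero eq | inj₂ (Y , _ , _ , Y≡1+X) =
    contradiction (≤-trans (≤-reflexive (sym (trans Y≡1+X (cong suc eq)))) (∣p∣≤n Y)) ℕ.1+n≰n
  climb X⊆Z all T (suc d) eq | inj₂ (Y , X⊂Y , Y⊆Z , Y≡1+X) =
    step X⊂Y (all Y (proj₁ X⊂Y) Y⊆Z)
      (climb Y⊆Z (λ W → all W ∘ ⊆-trans (proj₁ X⊂Y)) T d
        (trans (cong (d +_) Y≡1+X) (trans (ℕ.+-suc d _) eq)))

  fullTower-⊤ : FullTower ⊤
  fullTower-⊤ zero    _  = []
  fullTower-⊤ (suc d) eq =
    contradiction (≤-trans (s≤s (ℕ.m≤n+m N d))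
      (≤-reflexive (trans (cong (suc d +_) (sym (∣⊤∣≡n N))) eq))) ℕ.1+n≰n

-- By strictness `A` occurs at most once above the bottom, so skipping it costs one set. If it never
-- occurs, the top set is given up instead.
remove : ∀ {P : Subset N → Set} A → Tower (λ Y → Y ≡ A ⊎ P Y) X (suc t) → Tower P X t
remove {t = zero}  A _ = []
remove {t = suc t} A (step X⊂Y (inj₂ pY) T) = step X⊂Y pY (remove A T)
remove {t = suc t} {P = P} A (step X⊂A (inj₁ refl) (step A⊂Y pY T)) =
  step (⊂-trans X⊂A A⊂Y) (other A⊂Y pY) (drop A⊂Y T)
  where
  other : ∀ {Y} → A ⊂ Y → Y ≡ A ⊎ P Y → P Y
  other A⊂A (inj₁ refl) = contradiction A⊂A (⊂-irref refl)
  other _   (inj₂ pY)   = pY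

  drop : ∀ {Y t} → A ⊂ Y → Tower (λ Y → Y ≡ A ⊎ P Y) Y t → Tower P Y t
  drop A⊂Y []             = []
  drop A⊂Y (step Y⊂Z p T) =
    step Y⊂Z (other (⊂-trans A⊂Y Y⊂Z) p) (drop (⊂-trans A⊂Y Y⊂Z) T)

-- Strict monotonicity suffices because the indices are totally ordered: `j < i` would contradict
-- `f i ⊆ f j`.
chainCopy : (f : Fin t → Subset N) → (∀ i j → i Fin.< j → f i ⊂ f j) →
            InducedCopy (Chain t) (Boolean N)
chainCopy f f-mono = record
  { embed = f
  ; isOrderMonomorphism = record
    { isOrderHomomorphism = record { cong = cong f ; mono = λ {i} {j} → mono i j }
    ; injective = λ eq → Fin.≤-antisym (cancel _ _ (⊆-reflexive eq))
                                       (cancel _ _ (⊆-reflexive (sym eq)))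
    ; cancel = λ {i} {j} → cancel i j
    }
  }
  where
  mono : ∀ i j → i Fin.≤ j → f i ⊆ f j
  mono i j i≤j with i Fin.≟ j
  ... | yes refl = ⊆-refl
  ... | no i≢j   = proj₁ (f-mono i j (Fin.≤∧≢⇒< i≤j i≢j))

  cancel : ∀ i j → f i ⊆ f j → i Fin.≤ j
  cancel i j fi⊆fj = ℕ.≮⇒≥ λ j<i → ⊂-irref refl (⊂-⊆-trans (f-mono j i j<i) fi⊆fj)

chainCopy-mono : (A : InducedCopy (Chain t) (Boolean N)) → ∀ i j → i Fin.< j →
                 InducedCopy.embed A i ⊂ InducedCopy.embed A j
chainCopy-mono A i j i<j =
  ⊆∧≢⇒⊂ (A.mono (ℕ.<⇒≤ i<j)) λ eq → Fin.<⇒≢ i<j (A.injective eq)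
  where module A = IsOrderMonomorphism (InducedCopy.isOrderMonomorphism A)

-- Levels of the Boolean lattice

Level : ℕ → ℕ → Set
Level n k = Σ[ X ∈ Subset n ] ∣ X ∣ ≡ k

∣p∣≡0⇒p≡⊥ : ∣ X ∣ ≡ 0 → X ≡ ⊥
∣p∣≡0⇒p≡⊥ {X = []}          _  = refl
∣p∣≡0⇒p≡⊥ {X = outside ∷ X} eq = cong (outside ∷_) (∣p∣≡0⇒p≡⊥ eq)

level-zero : Level n 0 ↔ Fin 1
level-zero {n} = mk↔ₛ′ (λ _ → zero) (λ _ → ⊥ , ∣⊥∣≡0 n) (λ { zero → refl })
  λ { (X , eq) → unique X eq (∣⊥∣≡0 n) (∣p∣≡0⇒p≡⊥ eq) }
  where
  unique : ∀ X (eq : ∣ X ∣ ≡ 0) (eq′ : ∣ ⊥ {n} ∣ ≡ 0) → X ≡ ⊥ → (⊥ , eq′) ≡ (X , eq)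
  unique X eq eq′ refl = cong (⊥ ,_) (ℕ.≡-irrelevant eq′ eq)

level-suc : Level (suc n) (suc k) ↔ (Level n k ⊎ Level n (suc k))
level-suc = mk↔ₛ′
  (λ { (inside ∷ X , refl) → inj₁ (X , refl) ; (outside ∷ X , eq) → inj₂ (X , eq) })
  (λ { (inj₁ (X , eq)) → inside ∷ X , cong suc eq ; (inj₂ (X , eq)) → outside ∷ X , eq })
  (λ { (inj₁ (X , refl)) → refl ; (inj₂ _) → refl })
  (λ { (inside ∷ X , refl) → refl ; (outside ∷ X , eq) → refl })

-- Pascal's rule as a bijection. It counts the middle level for Sperner's theorem and numbers its
-- sets for the coloring.
level↔ : ∀ n k → Level n k ↔ Fin (n C k)
level↔ n       zero    = level-zero
level↔ zero    (suc k) = mk↔ₛ′ (λ { ([] , ()) }) (λ ()) (λ ()) (λ { ([] , ()) })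
level↔ (suc n) (suc k) = subst (λ m → Level (suc n) (suc k) ↔ Fin m)
  (nCk+nC[k+1]≡[n+1]C[k+1] n k)
  (↔-sym Fin.+↔⊎ ↔-∘ ((level↔ n k ⊎-↔ level↔ n (suc k)) ↔-∘ level-suc))

-- Sperner's theorem, through symmetric chain decompositions

-- SymChain n m indexes the chains with m + 1 sets in the recursive symmetric
-- chain decomposition of Boolean n: a chain X₀ ⊃ … ⊃ Xₘ of Boolean n gives rise
-- to the chain  long  with sets X₀ ∪ {new} ⊃ X₀ ⊃ … ⊃ Xₘ, and to the chain
-- short  with sets X₁ ∪ {new} ⊃ … ⊃ Xₘ ∪ {new}.
data SymChain : ℕ → ℕ → Set where
  nil   : SymChain 0 0
  long  : SymChain n m → SymChain (suc n) (suc m)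
  short : SymChain n (suc m) → SymChain (suc n) m

element : SymChain n m → Fin (suc m) → Subset n
element nil       _       = []
element (long d)  zero    = inside ∷ element d zero
element (long d)  (suc i) = outside ∷ element d i
element (short d) i       = inside ∷ element d (suc i)

element-antitone : (d : SymChain n m) → ∀ i j → i Fin.≤ j → element d j ⊆ element d i
element-antitone nil       _       _       _   = ⊆-refl
element-antitone (long d)  zero    zero    _   = ⊆-refl
element-antitone (long d)  zero    (suc j) _   = out⊆ (element-antitone d zero j z≤n)
element-antitone (long d)  (suc i) (suc j) i≤j = s⊆s (element-antitone d i j (s≤s⁻¹ i≤j))
element-antitone (short d) i       j       i≤j = s⊆s (element-antitone d (suc i) (suc j) (s≤s i≤j))

Position : ℕ → Set
Position n = ∃[ m ] SymChain n m × Fin (suc m)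

extend : Side → Position n → Position (suc n)
extend outside (m     , d , i)     = suc m , long d , suc i
extend inside  (m     , d , zero)  = suc m , long d , zero
extend inside  (suc m , d , suc i) = m , short d , i

locate : Subset n → Position n
locate []      = 0 , nil , zero
locate (s ∷ X) = extend s (locate X)

at : Position n → Subset n
at (_ , d , i) = element d i

at-extend : ∀ (s : Side) (p : Position n) → at (extend s p) ≡ s ∷ at p
at-extend outside (_     , _ , _)     = refl
at-extend inside  (_     , _ , zero)  = refl
at-extend inside  (suc _ , _ , suc _) = refl

-- With `locate-element` this shows that the chains partition the lattice.
at-locate : (X : Subset n) → at (locate X) ≡ X
at-locate []      = refl
at-locate (s ∷ X) = trans (at-extend s (locate X)) (cong (s ∷_) (at-locate X))

locate-element : (d : SymChain n m) → ∀ i → locate (element d i) ≡ (m , d , i)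
locate-element nil       zero    = refl
locate-element (long d)  zero    = cong (extend inside) (locate-element d zero)
locate-element (long d)  (suc i) = cong (extend outside) (locate-element d i)
locate-element (short d) i       = cong (extend inside) (locate-element d (suc i))

bottomRank : SymChain n m → ℕ
bottomRank nil       = 0
bottomRank (long d)  = bottomRank d
bottomRank (short d) = suc (bottomRank d)

-- With b the bottom rank, the ranks of the chain run from b to b + m; as 2b + m = n they are
-- symmetric about n/2, so every chain meets the middle level.
bottomRank-symmetric : (d : SymChain n m) → bottomRank d * 2 + m ≡ n
bottomRank-symmetric nil = refl
bottomRank-symmetric (long {m = m} d) =
  trans (ℕ.+-suc (bottomRank d * 2) m) (cong suc (bottomRank-symmetric d))
bottomRank-symmetric (short {m = m} d) =
  cong suc (trans (sym (ℕ.+-suc (bottomRank d * 2) m)) (bottomRank-symmetric d))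

∣element∣ : (d : SymChain n m) → ∀ i → ∣ element d i ∣ + toℕ i ≡ bottomRank d + m
∣element∣ nil       zero    = refl
∣element∣ (long {m = m} d) zero =
  trans (cong suc (∣element∣ d zero)) (sym (ℕ.+-suc (bottomRank d) m))
∣element∣ (long {m = m} d) (suc i) =
  trans (ℕ.+-suc _ (toℕ i)) (trans (cong suc (∣element∣ d i)) (sym (ℕ.+-suc (bottomRank d) m)))
∣element∣ (short {m = m} d) i =
  trans (sym (ℕ.+-suc _ (toℕ i))) (trans (∣element∣ d (suc i)) (ℕ.+-suc (bottomRank d) m))

⌈b*2+m/2⌉≡b+⌈m/2⌉ : ∀ b m → ⌈ b * 2 + m /2⌉ ≡ b + ⌈ m /2⌉
⌈b*2+m/2⌉≡b+⌈m/2⌉ zero    m = refl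
⌈b*2+m/2⌉≡b+⌈m/2⌉ (suc b) m = cong suc (⌈b*2+m/2⌉≡b+⌈m/2⌉ b m)

-- Chains are listed from the top down, so the floor in the index becomes the ceiling in the rank.
middle : ∀ m → Fin (suc m)
middle m = fromℕ< (s≤s (ℕ.⌊n/2⌋≤n m))

∣element-middle∣ : (d : SymChain n m) → ∣ element d (middle m) ∣ ≡ ⌈ n /2⌉
∣element-middle∣ {n} {m} d = ℕ.+-cancelʳ-≡ ⌊ m /2⌋ _ _ (begin
  ∣ element d (middle m) ∣ + ⌊ m /2⌋          ≡⟨ cong (∣ element d (middle m) ∣ +_)
                                                   (Fin.toℕ-fromℕ< (s≤s (ℕ.⌊n/2⌋≤n m))) ⟨
  ∣ element d (middle m) ∣ + toℕ (middle m)   ≡⟨ ∣element∣ d (middle m) ⟩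
  b + m                                       ≡⟨ cong (b +_) (ℕ.⌊n/2⌋+⌈n/2⌉≡n m) ⟨
  b + (⌊ m /2⌋ + ⌈ m /2⌉)                     ≡⟨ cong (b +_) (ℕ.+-comm ⌊ m /2⌋ ⌈ m /2⌉) ⟩
  b + (⌈ m /2⌉ + ⌊ m /2⌋)                     ≡⟨ ℕ.+-assoc b ⌈ m /2⌉ ⌊ m /2⌋ ⟨
  b + ⌈ m /2⌉ + ⌊ m /2⌋                       ≡⟨ cong (_+ ⌊ m /2⌋) (⌈b*2+m/2⌉≡b+⌈m/2⌉ b m) ⟨
  ⌈ b * 2 + m /2⌉ + ⌊ m /2⌋                   ≡⟨ cong (λ l → ⌈ l /2⌉ + ⌊ m /2⌋) (bottomRank-symmetric d) ⟩
  ⌈ n /2⌉ + ⌊ m /2⌋                           ∎)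
  where
  open ≡-Reasoning
  b = bottomRank d

Antichain : (Fin k → Subset n) → Set
Antichain f = ∀ i j → f i ⊆ f j → i ≡ j

-- Send each set to the middle set of its symmetric chain. Sets with the same image share a chain,
-- hence are comparable, so the map is injective on an antichain.
sperner : (f : Fin k → Subset n) → Antichain f → k ≤ n C ⌈ n /2⌉
sperner {k} {n} f anti = Fin.injective⇒≤ {f = Inverse.to (level↔ n ⌈ n /2⌉) ∘ centre ∘ locate ∘ f}
  λ {i} {j} eq → same i j (cong proj₁ (Injection.injective (↔⇒↣ (level↔ n ⌈ n /2⌉)) eq))
  where
  centre : Position n → Level n ⌈ n /2⌉
  centre (m , d , _) = element d (middle m) , ∣element-middle∣ d

  comparable : (p q : Position n) → proj₁ (centre p) ≡ proj₁ (centre q) →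
               at p ⊆ at q ⊎ at q ⊆ at p
  comparable (m , d , i) (m′ , d′ , i′) eq
    -- `locate` recovers a chain from its middle set.
    with refl ← trans (sym (locate-element d (middle m)))
                  (trans (cong locate eq) (locate-element d′ (middle m′)))
    with Fin.≤-total i i′
  ... | inj₁ i≤i′ = inj₂ (element-antitone d i i′ i≤i′)
  ... | inj₂ i′≤i = inj₁ (element-antitone d i′ i i′≤i)

  same : ∀ i j → proj₁ (centre (locate (f i))) ≡ proj₁ (centre (locate (f j))) → i ≡ j
  same i j eq with comparable (locate (f i)) (locate (f j)) eq
  ... | inj₁ le = anti i j (subst₂ _⊆_ (at-locate (f i)) (at-locate (f j)) le)
  ... | inj₂ ge = sym (anti j i (subst₂ _⊆_ (at-locate (f j)) (at-locate (f i)) ge))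

-- Padding with absent elements embeds the antichain in the larger lattice, which avoids comparing
-- binomial coefficients.
sperner-≤ : n ≤ m → (f : Fin k → Subset n) → Antichain f → k ≤ m C ⌈ m /2⌉
sperner-≤ n≤m = go (ℕ.≤⇒≤′ n≤m)
  where
  pad : n ≤′ m → Subset n → Subset m
  pad ≤′-refl       X = X
  pad (≤′-step n≤m) X = outside ∷ pad n≤m X

  pad-cancel : (n≤m : n ≤′ m) → pad n≤m X ⊆ pad n≤m Y → X ⊆ Y
  pad-cancel ≤′-refl       le = le
  pad-cancel (≤′-step n≤m) le = pad-cancel n≤m (drop-∷-⊆ le)

  go : n ≤′ m → (f : Fin k → Subset n) → Antichain f → k ≤ m C ⌈ m /2⌉
  go n≤m f anti = sperner (pad n≤m ∘ f) λ i j → anti i j ∘ pad-cancel n≤m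

-- Colorings without a rainbow chain of three sets

RainbowTriple : Coloring N k → Set
RainbowTriple c = ∃[ X ] ∃[ Y ] ∃[ Z ] (X ⊂ Y × Y ⊂ Z × c X ≢ c Y × c Y ≢ c Z × c X ≢ c Z)

rainbowTriple? : (c : Coloring N k) → Dec (RainbowTriple c)
rainbowTriple? c = anySubset? λ X → anySubset? λ Y → anySubset? λ Z →
  X ⊂? Y ×-dec Y ⊂? Z ×-dec ¬? (c X Fin.≟ c Y) ×-dec ¬? (c Y Fin.≟ c Z) ×-dec ¬? (c X Fin.≟ c Z)

rainbowCopy : (c : Coloring N k) → RainbowTriple c →
              Σ[ A ∈ InducedCopy (Chain 3) (Boolean N) ] Rainbow c (image A)
rainbowCopy {N} c (X , Y , Z , X⊂Y , Y⊂Z , X≢Y , Y≢Z , X≢Z) =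
  chainCopy (lookup tower) (lookup-mono tower) ,
  λ { (i , refl) (j , refl) ≢ ceq → ≢ (cong (lookup tower) (injective i j ceq)) }
  where
  tower : Tower (λ W → W ≡ W) X 2
  tower = step X⊂Y refl (step Y⊂Z refl [])

  injective : ∀ i j → c (lookup tower i) ≡ c (lookup tower j) → i ≡ j
  injective zero             zero             _  = refl
  injective zero             (suc zero)       eq = contradiction eq X≢Y
  injective zero             (suc (suc zero)) eq = contradiction eq X≢Z
  injective (suc zero)       zero             eq = contradiction (sym eq) X≢Y
  injective (suc zero)       (suc zero)       _  = refl
  injective (suc zero)       (suc (suc zero)) eq = contradiction eq Y≢Z
  injective (suc (suc zero)) zero             eq = contradiction (sym eq) X≢Z
  injective (suc (suc zero)) (suc zero)       eq = contradiction (sym eq) Y≢Z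
  injective (suc (suc zero)) (suc (suc zero)) _  = refl

module RainbowFree {N k} (c : Coloring N k) (free : ¬ RainbowTriple c) where

  z : Fin k
  z = c ⊥

  -- Otherwise `⊥`, `X`, `Y` would be a rainbow triple.
  ⊆⇒≡ : X ⊆ Y → c X ≢ z → c Y ≢ z → c X ≡ c Y
  ⊆⇒≡ {X} {Y} X⊆Y X≢z Y≢z = decidable-stable (c X Fin.≟ c Y) λ X≢Y → free
    (⊥ , X , Y
    , ⊆∧≢⇒⊂ ⊥⊆ (X≢z ∘ cong c ∘ sym)
    , ⊆∧≢⇒⊂ X⊆Y (X≢Y ∘ cong c)
    , X≢z ∘ sym , X≢Y , Y≢z ∘ sym)

  module _ (A B : Subset N) (A≢z : c A ≢ z) (B≢z : c B ≢ z) (A≢B : c A ≢ c B)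
           (closest : ∀ X → c X ≢ z → c X ≢ c B → hamming A B ≤ hamming X B) where

    private
      AOrZ : Subset N → Set
      AOrZ Y = Y ≡ A ⊎ c Y ≡ z

      unless : (c Y ≢ z → Y ≡ A) → AOrZ Y
      unless {Y} h with c Y Fin.≟ z
      ... | yes Y≡z = inj₂ Y≡z
      ... | no  Y≢z = inj₁ (h Y≢z)

      between : A ∩ B ⊆ Y → Y ⊆ A ∪ B → c Y ≡ c A → c Y ≢ z → Y ≡ A
      between {Y} l u Y≡A Y≢z = hamming-between-≡ A B Y l u
        (closest Y Y≢z (A≢B ∘ trans (sym Y≡A)))

    -- The segments end at `A ∩ B`, `A`, `A ∪ B` and `⊤`. On the first and last, a set of color
    -- other than `z` would share its color with both `A` and `B`; on the middle two it has the
    -- color of `A`, so `between` identifies it with `A`.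
    fullTower-avoiding : FullTower {P = AOrZ} ⊥
    fullTower-avoiding =
      climb ⊥⊆ (λ Y _ Y⊆ → unless λ Y≢z → contradiction
        (trans (sym (⊆⇒≡ (⊆-trans Y⊆ (p∩q⊆p A B)) Y≢z A≢z)) (⊆⇒≡ (⊆-trans Y⊆ (p∩q⊆q A B)) Y≢z B≢z)) A≢B) (
      climb (p∩q⊆p A B) (λ Y l Y⊆A → unless λ Y≢z →
        between l (⊆-trans Y⊆A (p⊆p∪q B)) (⊆⇒≡ Y⊆A Y≢z A≢z) Y≢z) (
      climb (p⊆p∪q B) (λ Y A⊆Y u → unless λ Y≢z →
        between (⊆-trans (p∩q⊆p A B) A⊆Y) u (sym (⊆⇒≡ A⊆Y A≢z Y≢z)) Y≢z) (
      climb ⊆⊤ (λ Y ⊆Y _ → unless λ Y≢z → contradiction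
        (trans (⊆⇒≡ (⊆-trans (p⊆p∪q B) ⊆Y) A≢z Y≢z) (sym (⊆⇒≡ (⊆-trans (q⊆p∪q A B) ⊆Y) B≢z Y≢z))) A≢B)
      fullTower-⊤)))

monochromaticCopy : (c : Coloring N k) → Tower (λ Y → c Y ≡ c ⊥) ⊥ t →
                    Σ[ A ∈ InducedCopy (Chain (suc t)) (Boolean N) ] Monochromatic c (image A)
monochromaticCopy c T = chainCopy (lookup T) (lookup-mono T) ,
  λ { (i , refl) (j , refl) → trans (lookup-∈ refl T i) (sym (lookup-∈ refl T j)) }

forced-large : 3 ≤ k → suc t ≤ N → Forced (Chain 3) (Chain (suc t)) k N
forced-large {N = suc N} (s≤s (s≤s (s≤s _))) (s≤s t≤N) c exact with rainbowTriple? c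
... | yes triple = inj₁ (rainbowCopy c triple)
... | no  free   = inj₂ (monochromaticCopy c (take t≤N (remove A
      (fullTower-avoiding A B A≢z B≢z A≢B (λ X X≢z X≢B → closest X (X≢z , X≢B))
        (suc N) (trans (cong (suc N +_) (∣⊥∣≡0 (suc N))) (ℕ.+-identityʳ _))))))
  where
  open RainbowFree c free
  -- As k ≥ 3, two colors besides `z` exist; `punchIn z` enumerates them.
  B = proj₁ (exact (punchIn z zero))
  A′ = proj₁ (exact (punchIn z (suc zero)))

  B≡ : c B ≡ punchIn z zero
  B≡ = proj₂ (exact (punchIn z zero))

  A′≡ : c A′ ≡ punchIn z (suc zero)
  A′≡ = proj₂ (exact (punchIn z (suc zero)))

  B≢z : c B ≢ z
  B≢z = Fin.punchInᵢ≢i z zero ∘ trans (sym B≡)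

  A′≢z : c A′ ≢ z
  A′≢z = Fin.punchInᵢ≢i z (suc zero) ∘ trans (sym A′≡)

  A′≢B : c A′ ≢ c B
  A′≢B eq with () ← Fin.punchIn-injective z _ _ (trans (sym A′≡) (trans eq B≡))

  -- `A′` only starts the search for the closest set.
  nearest = minimiser (λ X → hamming X B)
    (λ X → ¬? (c X Fin.≟ z) ×-dec ¬? (c X Fin.≟ c B)) (A′ , A′≢z , A′≢B)
  A = proj₁ nearest
  A≢z = proj₁ (proj₁ (proj₂ nearest))
  A≢B = proj₂ (proj₁ (proj₂ nearest))
  closest = proj₂ (proj₂ nearest)

exact⇒rainbow : N ≤ n → (n C ⌈ n /2⌉) + 1 < k → (c : Coloring N k) → Exact c → RainbowTriple c
exact⇒rainbow {N} {n} {suc k} N≤n C+1<k c exact with rainbowTriple? c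
... | yes triple = triple
... | no  free   = contradiction (sperner-≤ N≤n representative antichain)
      (ℕ.<⇒≱ (subst (_≤ k) (ℕ.+-comm _ 1) (s≤s⁻¹ C+1<k)))
  where
  open RainbowFree c free
  representative : Fin k → Subset N
  representative j = proj₁ (exact (punchIn z j))

  color : ∀ j → c (representative j) ≡ punchIn z j
  color j = proj₂ (exact (punchIn z j))

  ≢z : ∀ j → c (representative j) ≢ z
  ≢z j = Fin.punchInᵢ≢i z j ∘ trans (sym (color j))

  antichain : Antichain representative
  antichain i j le = Fin.punchIn-injective z i j
    (trans (sym (color i)) (trans (⊆⇒≡ le (≢z i) (≢z j)) (color j)))

-- Coloring the middle level

-- The default `zero` takes care of a level with more sets than available colors.
clamp : ℕ → Fin (suc n)
clamp {n} i with i ℕ.<? suc n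
... | yes i<1+n = fromℕ< i<1+n
... | no  _     = zero

clamp-toℕ : (j : Fin (suc n)) → clamp (toℕ j) ≡ j
clamp-toℕ {n} j with toℕ j ℕ.<? suc n
... | yes j<1+n = Fin.fromℕ<-toℕ j j<1+n
... | no  j≮1+n = contradiction (Fin.toℕ<n j) j≮1+n

module LevelColoring (N h k : ℕ) (k<C : suc k ≤ N C h) where

  coloring : Coloring N (suc (suc k))
  coloring X with ∣ X ∣ ℕ.≟ h
  ... | yes eq = suc (clamp (toℕ (Inverse.to (level↔ N h) (X , eq))))
  ... | no  _  = zero

  ≡h⇒suc : ∣ X ∣ ≡ h → ∃[ j ] coloring X ≡ suc j
  ≡h⇒suc {X} eq with ∣ X ∣ ℕ.≟ h
  ... | yes _  = _ , refl
  ... | no neq = contradiction eq neq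

  ≢h⇒zero : ∣ X ∣ ≢ h → coloring X ≡ zero
  ≢h⇒zero {X} neq with ∣ X ∣ ℕ.≟ h
  ... | yes eq = contradiction eq neq
  ... | no _   = refl

  exact : h ≢ 0 → Exact coloring
  exact h≢0 zero    = ⊥ , ≢h⇒zero (λ eq → h≢0 (trans (sym eq) (∣⊥∣≡0 N)))
  exact h≢0 (suc j) = proj₁ L , color
    where
    i : Fin (N C h)
    i = inject≤ j k<C

    L : Level N h
    L = Inverse.from (level↔ N h) i

    color : coloring (proj₁ L) ≡ suc j
    color with ∣ proj₁ L ∣ ℕ.≟ h
    ... | no neq = contradiction (proj₂ L) neq
    -- The size proof found by the test is replaced by that of `L`, so that the round trip through
    -- `level↔` cancels.
    ... | yes eq rewrite ℕ.≡-irrelevant eq (proj₂ L)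
                       | Inverse.strictlyInverseˡ (level↔ N h) i
                       | Fin.toℕ-inject≤ j k<C = cong suc (clamp-toℕ j)

  ⊂-≡h : X ⊂ Y → ∣ X ∣ ≡ h → ∣ Y ∣ ≢ h
  ⊂-≡h X⊂Y X≡h Y≡h = ℕ.<⇒≢ (p⊂q⇒∣p∣<∣q∣ X⊂Y) (trans X≡h (sym Y≡h))

  -- A chain meets the level at most once, so two of the three sets have color `zero`.
  ¬rainbow : ¬ RainbowTriple coloring
  ¬rainbow (X , Y , Z , X⊂Y , Y⊂Z , X≢Y , Y≢Z , X≢Z) = by-level (∣ X ∣ ℕ.≟ h) (∣ Y ∣ ℕ.≟ h)
    where
    by-level : Dec (∣ X ∣ ≡ h) → ¬ Dec (∣ Y ∣ ≡ h)
    by-level (yes X≡h) _ = Y≢Z (trans (≢h⇒zero (⊂-≡h X⊂Y X≡h))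
      (sym (≢h⇒zero (⊂-≡h (⊂-trans X⊂Y Y⊂Z) X≡h))))
    by-level (no X≢h) (yes Y≡h) = X≢Z (trans (≢h⇒zero X≢h) (sym (≢h⇒zero (⊂-≡h Y⊂Z Y≡h))))
    by-level (no X≢h) (no Y≢h) = X≢Y (trans (≢h⇒zero X≢h) (sym (≢h⇒zero Y≢h)))

  ¬rainbowCopy : ¬ (Σ[ A ∈ InducedCopy (Chain 3) (Boolean N) ] Rainbow coloring (image A))
  ¬rainbowCopy (A , rainbow) = ¬rainbow
    (f zero , f (suc zero) , f (suc (suc zero)) , f⊂ _ _ (s≤s z≤n) , f⊂ _ _ (s≤s (s≤s z≤n))
    , distinct _ _ (s≤s z≤n) , distinct _ _ (s≤s (s≤s z≤n)) , distinct _ _ (s≤s z≤n))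
    where
    f = InducedCopy.embed A
    f⊂ = chainCopy-mono A

    distinct : ∀ i j → i Fin.< j → coloring (f i) ≢ coloring (f j)
    distinct i j i<j = rainbow (i , refl) (j , refl) λ eq → ⊂-irref eq (f⊂ i j i<j)

  ¬monochromaticCopy : 1 ≤ N → h ≤ N →
    ¬ (Σ[ A ∈ InducedCopy (Chain (suc N)) (Boolean N) ] Monochromatic coloring (image A))
  ¬monochromaticCopy (s≤s _) h≤N (A , mono) =
    -- The N + 1 sets avoid rank `h`, which leaves N ranks; two sets would share one.
    let i , j , i<j , eq = Fin.pigeonhole (ℕ.n<1+n N) (λ i → punchOut (h≢rank i)) in
    ℕ.<⇒≢ (p⊂q⇒∣p∣<∣q∣ (chainCopy-mono A i j i<j))
      (Fin.fromℕ<-injective _ _ _ _ (Fin.punchOut-injective (h≢rank i) (h≢rank j) eq))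
    where
    f = InducedCopy.embed A

    -- If the bottom set were on the level, the next set would lie off it and have color `zero`.
    f₀≢h : ∣ f zero ∣ ≢ h
    f₀≢h ≡h = Fin.0≢1+n (trans
      (sym (≢h⇒zero (⊂-≡h (chainCopy-mono A zero (suc zero) (s≤s z≤n)) ≡h)))
      (trans (mono (suc zero , refl) (zero , refl)) (proj₂ (≡h⇒suc ≡h))))

    avoid : ∀ i → ∣ f i ∣ ≢ h
    avoid i ≡h = Fin.0≢1+n (trans (sym (≢h⇒zero f₀≢h))
      (trans (mono (zero , refl) (i , refl)) (proj₂ (≡h⇒suc ≡h))))

    rank : Fin (suc N) → Fin (suc N)
    rank i = fromℕ< (s≤s (∣p∣≤n (f i)))

    h≢rank : ∀ i → fromℕ< (s≤s h≤N) ≢ rank i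
    h≢rank i eq = avoid i (sym (Fin.fromℕ<-injective _ _ _ _ eq))

¬forced : 3 ≤ k → 2 ≤ N → k ≤ (N C ⌈ N /2⌉) + 1 → ¬ Forced (Chain 3) (Chain (suc N)) k N
¬forced {suc (suc k)} {N} (s≤s (s≤s _)) (s≤s (s≤s _)) k≤C+1 forced =
  [ ¬rainbowCopy , ¬monochromaticCopy (s≤s z≤n) (ℕ.⌈n/2⌉≤n N) ] (forced coloring (exact λ ()))
  where open LevelColoring N ⌈ N /2⌉ k (s≤s⁻¹ (subst (suc (suc k) ≤_) (ℕ.+-comm _ 1) k≤C+1))

theorem1p2 : (k s : ℕ) → 3 ≤ k → 3 ≤ s →
    (k ≤ ((s ∸ 1) C ⌈ s ∸ 1 /2⌉) + 1 → GR[ k , Chain 3 ∶ Chain s ]≡ s)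
    × (((s ∸ 1) C ⌈ s ∸ 1 /2⌉) + 1 < k → Good (Chain 3) (Chain s) k)
theorem1p2 k (suc N) 3≤k (s≤s 2≤N) = value , good
  where
  value : k ≤ (N C ⌈ N /2⌉) + 1 → GR[ k , Chain 3 ∶ Chain (suc N) ]≡ suc N
  value k≤ =
      (λ good → ¬forced 3≤k 2≤N k≤ (good N (ℕ.<⇒≤ 2≤N)))
    , (λ M → forced-large 3≤k)
    -- A threshold below s would cover dimension s - 1, where the level coloring is a
    -- counterexample.
    , (λ m forced → ℕ.≮⇒≥ λ m<1+N → ¬forced 3≤k 2≤N k≤ (forced N (s≤s⁻¹ m<1+N)))

  good : (N C ⌈ N /2⌉) + 1 < k → Good (Chain 3) (Chain (suc N)) k
  good C+1<k M _ with suc N ℕ.≤? M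
  ... | yes N<M = forced-large 3≤k N<M
  ... | no  N≮M = λ c exact → inj₁ (rainbowCopy c (exact⇒rainbow (s≤s⁻¹ (ℕ.≰⇒> N≮M)) C+1<k c exact))
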